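{- Let $x,y\in(0,1]$, and let $Z$ be the set of all $z\in(0,1]$ such that for every graph $G$, if $G$ is $(x,y)$-constrained via $(A,B,C)$, then $|N^2_A(v)|\ge z|A|$ for some $v\in C$. Then $\sup\{z : z\in Z\}$ belongs to $Z$.
   Context: All graphs are finite, with no loops or multiple edges. $(0,1]$ is the set of reals $t$ with $0<t\le 1$. A tripartition of a graph $G$ is a partition $(A,B,C)$ of $V(G)$ into three nonempty stable (independent) sets. For $x,y\in(0,1]$, $G$ is $(x,y)$-constrained via a tripartition $(A,B,C)$ if every vertex in $A$ has at least $x|B|$ neighbours in $B$, every vertex in $B$ has at least $y|C|$ neighbours in $C$, and there are no edges between $A$ and $C$. $N^2(v)$ is the set of vertices at distance exactly two from $v$, and $N^2_A(v)=N^2(v)\cap A$. -}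

module Defs where

open import Data.Bool.Base using (Bool; T)
open import Data.Bool.Properties using (T?)
open import Data.Fin.Base using (Fin)
open import Data.Fin.Properties using (any?; _≟_)
open import Data.Fin.Subset using (Subset; Nonempty; Empty; ⊤; _∩_; _∪_; ∣_∣)
  renaming (_∈_ to _∈ˢ_)
open import Data.Integer.Base using (+_)
open import Data.Nat.Base as ℕ using (ℕ; zero; suc)
open import Data.Nat.Properties using (allUpTo?)
open import Data.Product.Base using (∃; ∃-syntax; _×_; _,_)
open import Data.Rational.Base as ℚ using (ℚ; 0ℚ; 1ℚ)
open import Data.Rational.Literals using (fromℤ)
import Data.Rational.Properties as ℚₚ
open import Data.Vec.Base using (tabulate)
open import Level using (0ℓ)
open import Relation.Binary.PropositionalEquality.Core using (_≡_; refl; subst)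
open import Relation.Nullary using (¬_; Dec; does)
open import Relation.Nullary.Decidable using (_×-dec_; ¬?; map′)
open import Relation.Unary using (Pred; _∈_; _∉_)

------------------------------------------------------------------------
-- Real numbers

-- A real number is a Dedekind cut in Rudin's one-sided sense: a nonempty
-- proper initial segment of ℚ without greatest element, the real number
-- being the supremum of the segment.  No locatedness is required; classically
-- it is automatic, so that these are exactly the real numbers.

record ℝ : Set₁ where
  field
    cut       : Pred ℚ 0ℓ
    inhabited : ∃[ q ] q ∈ cut
    proper    : ∃[ u ] u ∉ cut
    closed    : ∀ {p q} → p ℚ.< q → q ∈ cut → p ∈ cut
    rounded   : ∀ {p} → p ∈ cut → ∃[ q ] p ℚ.< q × q ∈ cut

open ℝ public

infix 4 _≤_ _<_

_≤_ : ℝ → ℝ → Set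
x ≤ y = ∀ {q} → q ∈ cut x → q ∈ cut y

_<_ : ℝ → ℝ → Set
x < y = ∃[ q ] q ∈ cut y × q ∉ cut x

fromℚ : ℚ → ℝ
fromℚ r = record
  { cut       = ℚ._< r
  ; inhabited = r ℚ.- 1ℚ , subst (r ℚ.- 1ℚ ℚ.<_) (ℚₚ.+-identityʳ r)
                             (ℚₚ.+-monoʳ-< r (ℚₚ.negative⁻¹ (ℚ.- 1ℚ)))
  ; proper    = r , ℚₚ.<-irrefl refl
  ; closed    = ℚₚ.<-trans
  ; rounded   = ℚₚ.<-dense
  }

fromℕ : ℕ → ℝ
fromℕ n = fromℚ (fromℤ (+ n))

infixr 7 _·_

-- The product of a natural number and a real number.  The strict inequality
-- makes the segment open also for n = 0, where it is {q | q < 0}.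

_·_ : ℕ → ℝ → ℝ
n · x = record
  { cut       = λ q → ∃[ p ] p ∈ cut x × q ℚ.< n′ ℚ.* p
  ; inhabited = let p , p∈x = inhabited x
                    q , q<np = inhabited (fromℚ (n′ ℚ.* p))
                in q , p , p∈x , q<np
  ; proper    = let u , u∉x = proper x
                in n′ ℚ.* u , λ (p , p∈x , nu<np) →
                     u∉x (closed x (ℚₚ.*-cancelˡ-<-nonNeg n′ nu<np) p∈x)
  ; closed    = λ q<r (p , p∈x , r<np) → p , p∈x , ℚₚ.<-trans q<r r<np
  ; rounded   = λ (p , p∈x , q<np) →
                  let r , q<r , r<np = ℚₚ.<-dense q<np
                  in r , q<r , p , p∈x , r<np
  }
  where n′ = fromℤ (+ n)

-- The half-open interval (0,1].

⟨0,1] : Pred ℝ 0ℓ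
⟨0,1] x = fromℕ 0 < x × x ≤ fromℕ 1

IsUpperBound : Pred ℝ 0ℓ → ℝ → Set₁
IsUpperBound P u = ∀ z → z ∈ P → z ≤ u

IsSupremum : Pred ℝ 0ℓ → ℝ → Set₁
IsSupremum P s = IsUpperBound P s × (∀ u → IsUpperBound P u → s ≤ u)

------------------------------------------------------------------------
-- Graphs

-- Adjacency is Boolean-valued so that graphs, and hence sets of reals defined
-- by quantifying over all graphs, live in the lowest universe.

record Graph (n : ℕ) : Set where
  field
    adj     : Fin n → Fin n → Bool
    adj-sym : ∀ u v → adj u v ≡ adj v u
    no-loop : ∀ v → ¬ T (adj v v)

  infix 4 _~_

  _~_ : Fin n → Fin n → Set
  u ~ v = T (adj u v)

  data Walk : ℕ → Fin n → Fin n → Set where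
    []  : ∀ {v} → Walk 0 v v
    _∷_ : ∀ {k u v w} → u ~ v → Walk k v w → Walk (suc k) u w

  Distance : ℕ → Fin n → Fin n → Set
  Distance k u v = Walk k u v × (∀ {j} → j ℕ.< k → ¬ Walk j u v)

  walk? : ∀ k u v → Dec (Walk k u v)
  walk? zero    u v = map′ (λ { refl → [] }) (λ { [] → refl }) (u ≟ v)
  walk? (suc k) u w = map′ (λ (_ , e , p) → e ∷ p) (λ { (e ∷ p) → _ , e , p })
                           (any? λ v → T? (adj u v) ×-dec walk? k v w)

  distance? : ∀ k u v → Dec (Distance k u v)
  distance? k u v = walk? k u v ×-dec allUpTo? (λ j → ¬? (walk? j u v)) k

  N : Fin n → Subset n
  N v = tabulate (adj v)

  N² : Fin n → Subset n
  N² v = tabulate (λ w → does (distance? 2 v w))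

module _ {n : ℕ} (G : Graph n) where
  open Graph G

  Stable : Subset n → Set
  Stable S = ∀ {u v} → u ∈ˢ S → v ∈ˢ S → ¬ u ~ v

  record Tripartition (A B C : Subset n) : Set where
    field
      A-nonempty : Nonempty A
      B-nonempty : Nonempty B
      C-nonempty : Nonempty C
      A-stable   : Stable A
      B-stable   : Stable B
      C-stable   : Stable C
      A∩B-empty  : Empty (A ∩ B)
      A∩C-empty  : Empty (A ∩ C)
      B∩C-empty  : Empty (B ∩ C)
      covers     : A ∪ B ∪ C ≡ ⊤

  record Constrained (x y : ℝ) (A B C : Subset n) : Set where
    field
      tripartition : Tripartition A B C
      A-to-B       : ∀ {v} → v ∈ˢ A → ∣ B ∣ · x ≤ fromℕ ∣ N v ∩ B ∣
      B-to-C       : ∀ {v} → v ∈ˢ B → ∣ C ∣ · y ≤ fromℕ ∣ N v ∩ C ∣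
      no-A-C       : ∀ {u v} → u ∈ˢ A → v ∈ˢ C → ¬ u ~ v

Z : ℝ → ℝ → Pred ℝ 0ℓ
Z x y z = z ∈ ⟨0,1] ×
  (∀ {n} (G : Graph n) (A B C : Subset n) → Constrained G x y A B C →
   ∃[ v ] v ∈ˢ C × ∣ A ∣ · z ≤ fromℕ ∣ Graph.N² G v ∩ A ∣)

-- Only rational thresholds matter: s is the supremum of the rationals r ≤ 1
-- such that every constrained graph has a vertex v ∈ C with |N²_A(v)| ≥ r|A|.
-- In a fixed graph a vertex of C maximising |N²_A| serves all these r
-- simultaneously, hence also s, so s ∈ Z once s > 0.  For s > 0, every vertex
-- of A has a neighbour in B, hence at least y|C| second neighbours in C;
-- double counting the pairs of A × C at distance two gives every positive
-- rational r < y as a threshold.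

module Submission where

open import Defs
open import Data.Bool.Base using (Bool; true; false; T)
open import Data.Bool.Properties using (T-≡)
open import Data.Fin.Base using (Fin; zero; suc)
open import Data.Fin.Subset using (Subset; Nonempty; _⊆_; _∩_; ∣_∣; inside; outside)
  renaming (_∈_ to _∈ˢ_)
open import Data.Fin.Subset.Properties
  using (_∈?_; nonempty?; Empty-unique; ∣⊥∣≡0; x∈p⇒∣p-x∣<∣p∣; p⊆q⇒∣p∣≤∣q∣; x∈p∩q⁺; x∈p∩q⁻)
open import Data.Integer.Base as ℤ using (+_; +≤+; +<+)
import Data.Integer.Properties as ℤₚ
open import Data.List.Base using (List; allFin; filter)
open import Data.List.Extrema.Nat
  using (argmax; argmin; argmax-all; argmin-all; f[xs]≤f[argmax]; f[argmin]≤f[xs])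
open import Data.List.Membership.Propositional.Properties using (∈-allFin; ∈-filter⁺)
import Data.List.Relation.Unary.All as All
open import Data.List.Relation.Unary.All.Properties using (all-filter)
open import Data.Nat.Base as ℕ using (ℕ; zero; suc; z≤n; s≤s)
import Data.Nat.Properties as ℕₚ
open import Data.Product.Base using (_×_; _,_; proj₁; proj₂; ∃-syntax)
open import Data.Rational.Base as ℚ using (ℚ; 0ℚ; 1ℚ)
open import Data.Rational.Literals using (fromℤ)
import Data.Rational.Properties as ℚₚ
import Data.Rational.Unnormalised.Base as ℚᵘ
import Data.Rational.Unnormalised.Properties as ℚᵘₚ
open import Data.Vec.Base using ([]; _∷_; lookup; tabulate; here; there)
open import Data.Vec.Properties using (lookup∘tabulate; tabulate∘lookup; []=⇒lookup; lookup⇒[]=)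
open import Algebra.Bundles using (CommutativeMonoid)
open import Algebra.Properties.Semiring.Sum ℕₚ.+-*-semiring
  using (sum; sum-cong-≗; ∑-comm; *-distribˡ-sum)
open import Algebra.Properties.CommutativeSemigroup ℕₚ.*-commutativeSemigroup
  using (x∙yz≈y∙xz)
open import Algebra.Properties.CommutativeSemigroup
  (CommutativeMonoid.commutativeSemigroup ℚₚ.*-1-commutativeMonoid)
  using () renaming (x∙yz≈y∙xz to x*yz≡y*xz)
open import Function.Base using (_∘_)
open import Function.Bundles using (Equivalence)
open import Level using (0ℓ)
open import Relation.Binary.PropositionalEquality
  using (_≡_; refl; sym; trans; cong; subst; module ≡-Reasoning)
open import Relation.Nullary using (¬_; yes; no; contradiction)
open import Relation.Nullary.Decidable using (dec-true)
open import Relation.Unary using (Pred; _∈_)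

-- Finite subsets

module _ {n} (f : Fin n → ℕ) {S : Subset n} where

  private
    elements : List (Fin n)
    elements = filter (_∈? S) (allFin n)

  maximiser : Nonempty S → ∃[ i ] i ∈ˢ S × (∀ {j} → j ∈ˢ S → f j ℕ.≤ f i)
  maximiser (i , i∈S) =
    -- The given element of `S` is the default value of `argmax`, so the result lies in `S`.
    argmax f i elements ,
    argmax-all f i∈S (all-filter (_∈? S) (allFin n)) ,
    λ {j} j∈S → All.lookup (f[xs]≤f[argmax] i elements) (∈-filter⁺ (_∈? S) (∈-allFin j) j∈S)

  minimiser : Nonempty S → ∃[ i ] i ∈ˢ S × (∀ {j} → j ∈ˢ S → f i ℕ.≤ f j)
  minimiser (i , i∈S) =
    argmin f i elements ,
    argmin-all f i∈S (all-filter (_∈? S) (allFin n)) ,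
    λ {j} j∈S → All.lookup (f[argmin]≤f[xs] i elements) (∈-filter⁺ (_∈? S) (∈-allFin j) j∈S)

Nonempty⇒0<∣p∣ : ∀ {n} {p : Subset n} → Nonempty p → 0 ℕ.< ∣ p ∣
Nonempty⇒0<∣p∣ (_ , x∈p) = ℕₚ.≤-<-trans z≤n (x∈p⇒∣p-x∣<∣p∣ x∈p)

0<∣p∣⇒Nonempty : ∀ {n} {p : Subset n} → 0 ℕ.< ∣ p ∣ → Nonempty p
0<∣p∣⇒Nonempty {n} {p} 0<∣p∣ with nonempty? p
... | yes ne = ne
... | no  ¬ne = contradiction (trans (cong ∣_∣ (Empty-unique ¬ne)) (∣⊥∣≡0 n))
                              (ℕₚ.<⇒≢ 0<∣p∣ ∘ sym)

∈-tabulate⁺ : ∀ {n} {f : Fin n → Bool} {i} → f i ≡ true → i ∈ˢ tabulate f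
∈-tabulate⁺ {f = f} {i} fi = lookup⇒[]= i _ (trans (lookup∘tabulate f i) fi)

∈-tabulate⁻ : ∀ {n} {f : Fin n → Bool} {i} → i ∈ˢ tabulate f → f i ≡ true
∈-tabulate⁻ {f = f} {i} i∈ = trans (sym (lookup∘tabulate f i)) ([]=⇒lookup i∈)

-- Double counting

[_] : Bool → ℕ
[ true  ] = 1
[ false ] = 0

-- Weighting by the indicator of `S` keeps every sum over all of `Fin n`, so that exchanging two
-- sums is an instance of `∑-comm`.
∑∈ : ∀ {n} → Subset n → (Fin n → ℕ) → ℕ
∑∈ S f = sum λ i → [ lookup S i ] ℕ.* f i

∣tabulate∩∣≡∑∈ : ∀ {n} (f : Fin n → Bool) (S : Subset n) →
                 ∣ tabulate f ∩ S ∣ ≡ ∑∈ S ([_] ∘ f)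
∣tabulate∩∣≡∑∈ f [] = refl
∣tabulate∩∣≡∑∈ f (s ∷ S) with f zero | s
... | true  | true  = cong suc (∣tabulate∩∣≡∑∈ (f ∘ suc) S)
... | true  | false = ∣tabulate∩∣≡∑∈ (f ∘ suc) S
... | false | true  = ∣tabulate∩∣≡∑∈ (f ∘ suc) S
... | false | false = ∣tabulate∩∣≡∑∈ (f ∘ suc) S

∣S∣*k≤∑∈ : ∀ {n} (S : Subset n) {f : Fin n → ℕ} {k} →
           (∀ {i} → i ∈ˢ S → k ℕ.≤ f i) → ∣ S ∣ ℕ.* k ℕ.≤ ∑∈ S f
∣S∣*k≤∑∈ []            k≤f = z≤n
∣S∣*k≤∑∈ (outside ∷ S) k≤f = ∣S∣*k≤∑∈ S (k≤f ∘ there)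
∣S∣*k≤∑∈ (inside  ∷ S) {f} k≤f =
  ℕₚ.+-mono-≤ (ℕₚ.≤-trans (k≤f here) (ℕₚ.≤-reflexive (sym (ℕₚ.*-identityˡ (f zero)))))
              (∣S∣*k≤∑∈ S (k≤f ∘ there))

∑∈≤∣S∣*k : ∀ {n} (S : Subset n) {f : Fin n → ℕ} {k} →
           (∀ {i} → i ∈ˢ S → f i ℕ.≤ k) → ∑∈ S f ℕ.≤ ∣ S ∣ ℕ.* k
∑∈≤∣S∣*k []            f≤k = z≤n
∑∈≤∣S∣*k (outside ∷ S) f≤k = ∑∈≤∣S∣*k S (f≤k ∘ there)
∑∈≤∣S∣*k (inside  ∷ S) {f} f≤k =
  ℕₚ.+-mono-≤ (ℕₚ.≤-trans (ℕₚ.≤-reflexive (ℕₚ.*-identityˡ (f zero))) (f≤k here))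
              (∑∈≤∣S∣*k S (f≤k ∘ there))

∑∈-comm : ∀ {m n} (A : Subset m) (C : Subset n) (f : Fin m → Fin n → ℕ) →
          ∑∈ A (λ a → ∑∈ C (f a)) ≡ ∑∈ C (λ c → ∑∈ A (λ a → f a c))
∑∈-comm A C f = begin
  sum (λ a → χA a ℕ.* sum (λ c → χC c ℕ.* f a c))
    ≡⟨ sum-cong-≗ (λ a → *-distribˡ-sum (χA a) λ c → χC c ℕ.* f a c) ⟩
  sum (λ a → sum λ c → χA a ℕ.* (χC c ℕ.* f a c))
    ≡⟨ ∑-comm (λ a c → χA a ℕ.* (χC c ℕ.* f a c)) ⟩
  sum (λ c → sum λ a → χA a ℕ.* (χC c ℕ.* f a c))
    ≡⟨ sum-cong-≗ (λ c → sum-cong-≗ λ a → x∙yz≈y∙xz (χA a) (χC c) (f a c)) ⟩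
  sum (λ c → sum λ a → χC c ℕ.* (χA a ℕ.* f a c))
    ≡⟨ sum-cong-≗ (λ c → *-distribˡ-sum (χC c) λ a → χA a ℕ.* f a c) ⟨
  sum (λ c → χC c ℕ.* sum (λ a → χA a ℕ.* f a c)) ∎
  where
  open ≡-Reasoning
  χA = [_] ∘ lookup A
  χC = [_] ∘ lookup C

-- Both sides estimate the number of pairs of `A × C` related by `R`: from below by rows, from above
-- by columns.
double-counting : ∀ {m n} (R : Fin m → Fin n → Bool) (A : Subset m) (C : Subset n) {k M} →
                  (∀ {a} → a ∈ˢ A → k ℕ.≤ ∣ tabulate (R a) ∩ C ∣) →
                  (∀ {c} → c ∈ˢ C → ∣ tabulate (λ a → R a c) ∩ A ∣ ℕ.≤ M) →
                  ∣ A ∣ ℕ.* k ℕ.≤ ∣ C ∣ ℕ.* M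
double-counting R A C {k} {M} rows columns = begin
  ∣ A ∣ ℕ.* k
    ≤⟨ ∣S∣*k≤∑∈ A (λ {a} a∈A → subst (k ℕ.≤_) (∣tabulate∩∣≡∑∈ (R a) C) (rows a∈A)) ⟩
  ∑∈ A (λ a → ∑∈ C ([_] ∘ R a))
    ≡⟨ ∑∈-comm A C (λ a c → [ R a c ]) ⟩
  ∑∈ C (λ c → ∑∈ A (λ a → [ R a c ]))
    ≤⟨ ∑∈≤∣S∣*k C (λ {c} c∈C → subst (ℕ._≤ M) (∣tabulate∩∣≡∑∈ (λ a → R a c) A) (columns c∈C)) ⟩
  ∣ C ∣ ℕ.* M ∎
  where open ℕₚ.≤-Reasoning

-- Rational and real numbers

⌜_⌝ : ℕ → ℚ
⌜ n ⌝ = fromℤ (+ n)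

⌜⌝-mono-≤ : ∀ {m n} → m ℕ.≤ n → ⌜ m ⌝ ℚ.≤ ⌜ n ⌝
⌜⌝-mono-≤ m≤n = ℚ.*≤* (ℤₚ.*-monoʳ-≤-nonNeg (+ 1) (+≤+ m≤n))

⌜⌝-mono-< : ∀ {m n} → m ℕ.< n → ⌜ m ⌝ ℚ.< ⌜ n ⌝
⌜⌝-mono-< m<n = ℚ.*<* (ℤₚ.*-monoʳ-<-pos (+ 1) (+<+ m<n))

⌜⌝-cancel-< : ∀ {m n} → ⌜ m ⌝ ℚ.< ⌜ n ⌝ → m ℕ.< n
⌜⌝-cancel-< {m} {n} m<n =
  ℕₚ.≰⇒> λ n≤m → ℚₚ.<-irrefl refl (ℚₚ.<-≤-trans m<n (⌜⌝-mono-≤ n≤m))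

⌜⌝-homo-* : ∀ m n → ⌜ m ℕ.* n ⌝ ≡ ⌜ m ⌝ ℚ.* ⌜ n ⌝
⌜⌝-homo-* m n = ℚₚ.toℚᵘ-injective (ℚᵘₚ.≃-trans
  (ℚᵘ.*≡* (cong (ℤ._* + 1) (ℤₚ.pos-* m n)))
  (ℚᵘₚ.≃-sym (ℚₚ.toℚᵘ-homo-* ⌜ m ⌝ ⌜ n ⌝)))

*-pos : ∀ {p q} → 0ℚ ℚ.< p → 0ℚ ℚ.< q → 0ℚ ℚ.< p ℚ.* q
*-pos {p} {q} 0<p 0<q =
  subst (ℚ._< p ℚ.* q) (ℚₚ.*-zeroʳ p)
        (ℚₚ.*-monoʳ-<-pos p {{ℚ.positive 0<p}} 0<q)

·≤fromℕ⁺ : ∀ {n k} (z : ℝ) → (∀ {p} → p ∈ cut z → ⌜ n ⌝ ℚ.* p ℚ.≤ ⌜ k ⌝) → n · z ≤ fromℕ k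
·≤fromℕ⁺ z np≤k (p , p∈z , q<np) = ℚₚ.<-≤-trans q<np (np≤k p∈z)

-- If `k` were below `n` times `p`, the rational `k` would lie in the cut of `n · z`, hence in that
-- of `fromℕ k`, and so below itself.
·≤fromℕ⁻ : ∀ {n k} (z : ℝ) → n · z ≤ fromℕ k → ∀ {p} → p ∈ cut z → ⌜ n ⌝ ℚ.* p ℚ.≤ ⌜ k ⌝
·≤fromℕ⁻ z nz≤k p∈z = ℚₚ.≮⇒≥ λ k<np → ℚₚ.<-irrefl refl (nz≤k (_ , p∈z , k<np))

-- The witness of `fromℕ 0 < x` is only known to be nonnegative; roundedness gives a larger,
-- positive one.
positive-member : ∀ (x : ℝ) → fromℕ 0 < x → ∃[ p ] 0ℚ ℚ.< p × p ∈ cut x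
positive-member x (q , q∈x , q≮0) =
  let p , q<p , p∈x = rounded x q∈x in p , ℚₚ.≤-<-trans (ℚₚ.≮⇒≥ q≮0) q<p , p∈x

-- Rational thresholds

-- Thresholds are rational for reasons of size: a union of the cuts of all `z` in `Z x y` quantifies
-- over `ℝ : Set₁` and could not serve as a `Pred ℚ 0ℓ`.
Guaranteed : ℝ → ℝ → Pred ℚ 0ℓ
Guaranteed x y r =
  ∀ {n} (G : Graph n) (A B C : Subset n) → Constrained G x y A B C →
  ∃[ v ] v ∈ˢ C × ⌜ ∣ A ∣ ⌝ ℚ.* r ℚ.≤ ⌜ ∣ Graph.N² G v ∩ A ∣ ⌝

module _ {x y : ℝ} where

  Z⇒Guaranteed : ∀ {z r} → z ∈ Z x y → r ∈ cut z → Guaranteed x y r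
  Z⇒Guaranteed {z} (_ , Zz) r∈z G A B C con =
    let v , v∈C , bound = Zz G A B C con in v , v∈C , ·≤fromℕ⁻ z bound r∈z

  -- The vertex that a threshold provides may vary with the threshold, but one vertex must serve all
  -- `p` in the cut of `z`. It is therefore chosen first, as a maximiser, and dominates each of the
  -- others.
  below-Guaranteed : ∀ (z : ℝ) → (∀ {p} → p ∈ cut z → ∃[ r ] p ℚ.< r × Guaranteed x y r) →
    ∀ {n} (G : Graph n) (A B C : Subset n) → Constrained G x y A B C →
    ∃[ v ] v ∈ˢ C × ∣ A ∣ · z ≤ fromℕ ∣ Graph.N² G v ∩ A ∣
  below-Guaranteed z below G A B C con =
    let open Constrained con
        open Tripartition tripartition
        v , v∈C , v-max = maximiser (λ c → ∣ Graph.N² G c ∩ A ∣) C-nonempty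
    in v , v∈C , ·≤fromℕ⁺ z λ p∈z →
      let r , p<r , guaranteed = below p∈z
          w , w∈C , bound = guaranteed G A B C con
      in ℚₚ.≤-trans (ℚₚ.*-monoˡ-≤-nonNeg ⌜ ∣ A ∣ ⌝ (ℚₚ.<⇒≤ p<r))
           (ℚₚ.≤-trans bound (⌜⌝-mono-≤ (v-max w∈C)))

  Guaranteed⇒Z : ∀ {r} → 0ℚ ℚ.< r → r ℚ.≤ 1ℚ → Guaranteed x y r → fromℚ r ∈ Z x y
  Guaranteed⇒Z {r} 0<r r≤1 guaranteed =
    ((0ℚ , 0<r , ℚₚ.<-irrefl refl) , λ q<r → ℚₚ.<-≤-trans q<r r≤1) ,
    below-Guaranteed (fromℚ r) λ p<r → r , p<r , guaranteed

-- Pairs of A × C at distance two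

module _ {n} (G : Graph n) {x y : ℝ} {A B C : Subset n} (con : Constrained G x y A B C) where
  open Graph G
  open Constrained con
  open Tripartition tripartition

  ~-sym : ∀ {u v} → u ~ v → v ~ u
  ~-sym {u} {v} = subst T (adj-sym u v)

  ∈N⁻ : ∀ {u v} → v ∈ˢ N u → u ~ v
  ∈N⁻ v∈Nu = Equivalence.from T-≡ (∈-tabulate⁻ v∈Nu)

  -- For a positive `p` in the cut of `x`, the number of neighbours of `a` in `B` is at least
  -- `∣ B ∣` times `p`, which is positive because `B` is nonempty.
  neighbour-in-B : fromℕ 0 < x → ∀ {a} → a ∈ˢ A → ∃[ b ] b ∈ˢ B × a ~ b
  neighbour-in-B 0<x a∈A =
    let p , 0<p , p∈x = positive-member x 0<x
        0<∣B∣p = *-pos (⌜⌝-mono-< (Nonempty⇒0<∣p∣ B-nonempty)) 0<p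
        b , b∈ = 0<∣p∣⇒Nonempty (⌜⌝-cancel-<
                   (ℚₚ.<-≤-trans 0<∣B∣p (·≤fromℕ⁻ x (A-to-B a∈A) p∈x)))
        b∈Na , b∈B = x∈p∩q⁻ _ B b∈
    in b , b∈B , ∈N⁻ b∈Na

  -- A walk of length 0 would put `a` in both `A` and `C`; one of length 1 would be an edge between
  -- `A` and `C`.
  distance-two : ∀ {a b c} → a ∈ˢ A → c ∈ˢ C → a ~ b → b ~ c → Distance 2 c a
  distance-two {a} {b} {c} a∈A c∈C a~b b~c = (~-sym b~c ∷ (~-sym a~b ∷ [])) , no-shorter
    where
    no-shorter : ∀ {j} → j ℕ.< 2 → ¬ Walk j c a
    no-shorter _ [] = A∩C-empty (a , x∈p∩q⁺ (a∈A , c∈C))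
    no-shorter _ (c~a ∷ []) = no-A-C a∈A c∈C (~-sym c~a)
    no-shorter (s≤s (s≤s ())) (_ ∷ (_ ∷ _))

  -- Every neighbour in `C` of a neighbour `b` of `a` is at distance two from `a`, so the bound for
  -- `b` carries over. The set collects the `c` with `a` in `N² c`, the form in which double
  -- counting meets it.
  second-neighbours : fromℕ 0 < x → ∀ {p} → p ∈ cut y → ∀ {a} → a ∈ˢ A →
    ⌜ ∣ C ∣ ⌝ ℚ.* p ℚ.≤ ⌜ ∣ tabulate (λ c → lookup (N² c) a) ∩ C ∣ ⌝
  second-neighbours 0<x p∈y {a} a∈A =
    let b , b∈B , a~b = neighbour-in-B 0<x a∈A
        N∩C⊆ : N b ∩ C ⊆ tabulate (λ c → lookup (N² c) a) ∩ C
        N∩C⊆ {c} c∈ =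
          let c∈Nb , c∈C = x∈p∩q⁻ (N b) C c∈
              dist = distance-two a∈A c∈C a~b (∈N⁻ c∈Nb)
              a∈N²c : lookup (N² c) a ≡ true
              a∈N²c = trans (lookup∘tabulate _ a) (dec-true (distance? 2 c a) dist)
          in x∈p∩q⁺ (∈-tabulate⁺ a∈N²c , c∈C)
    in ℚₚ.≤-trans (·≤fromℕ⁻ y (B-to-C b∈B) p∈y) (⌜⌝-mono-≤ (p⊆q⇒∣p∣≤∣q∣ N∩C⊆))

y-Guaranteed : ∀ {x y : ℝ} → fromℕ 0 < x → ∀ {p} → p ∈ cut y → Guaranteed x y p
y-Guaranteed {x} {y} 0<x {p} p∈y G A B C con = v , v∈C ,
  ℚₚ.*-cancelˡ-≤-pos ⌜ ∣ C ∣ ⌝ {{ℚ.positive (⌜⌝-mono-< (Nonempty⇒0<∣p∣ C-nonempty))}} (begin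
    ⌜ ∣ C ∣ ⌝ ℚ.* (⌜ ∣ A ∣ ⌝ ℚ.* p)  ≡⟨ x*yz≡y*xz ⌜ ∣ C ∣ ⌝ ⌜ ∣ A ∣ ⌝ p ⟩
    ⌜ ∣ A ∣ ⌝ ℚ.* (⌜ ∣ C ∣ ⌝ ℚ.* p)
      ≤⟨ ℚₚ.*-monoˡ-≤-nonNeg ⌜ ∣ A ∣ ⌝ (second-neighbours G con 0<x p∈y a∈A) ⟩
    ⌜ ∣ A ∣ ⌝ ℚ.* ⌜ k ⌝              ≡⟨ ⌜⌝-homo-* ∣ A ∣ k ⟨
    ⌜ ∣ A ∣ ℕ.* k ⌝                  ≤⟨ ⌜⌝-mono-≤ (double-counting R A C a-min columns) ⟩
    ⌜ ∣ C ∣ ℕ.* M ⌝                  ≡⟨ ⌜⌝-homo-* ∣ C ∣ M ⟩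
    ⌜ ∣ C ∣ ⌝ ℚ.* ⌜ M ⌝              ∎)
  where
  open Graph G
  open Constrained con
  open Tripartition tripartition
  open ℚₚ.≤-Reasoning

  R : Fin _ → Fin _ → Bool
  R a c = lookup (N² c) a

  row : Fin _ → ℕ
  row a = ∣ tabulate (R a) ∩ C ∣

  column : Fin _ → ℕ
  column c = ∣ N² c ∩ A ∣

  -- The lower bound on rows is the rational `∣ C ∣` times `p`, whereas double counting takes a
  -- natural number: the least row size is one, and it still satisfies that bound.
  least = minimiser row A-nonempty
  a = proj₁ least
  a∈A = proj₁ (proj₂ least)

  a-min : ∀ {a′} → a′ ∈ˢ A → row a ℕ.≤ row a′
  a-min = proj₂ (proj₂ least)

  greatest = maximiser column C-nonempty
  v = proj₁ greatest
  v∈C = proj₁ (proj₂ greatest)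
  k = row a
  M = column v

  columns : ∀ {c} → c ∈ˢ C → ∣ tabulate (λ a → R a c) ∩ A ∣ ℕ.≤ M
  -- Column `c` of `R` tabulates the entries of `N² c`, so it is `N² c` itself.
  columns {c} c∈C = subst (λ S → ∣ S ∩ A ∣ ℕ.≤ M) (sym (tabulate∘lookup (N² c)))
                          (proj₂ (proj₂ greatest) c∈C)

-- The supremum and its membership

mainTheorem3 : ∀ (x y : ℝ) → x ∈ ⟨0,1] → y ∈ ⟨0,1] →
    ∃[ s ] (IsSupremum (Z x y) s × s ∈ Z x y)
mainTheorem3 x y (0<x , _) (0<y , y≤1) = s , (upper , least) , s∈Z
  where
  -- One positive threshold, fixed here, makes the cut of `s` inhabited, makes `s` positive, and
  -- stands in for nonpositive thresholds in `least`.
  p₀ : ∃[ p ] 0ℚ ℚ.< p × p ∈ cut y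
  p₀ = positive-member y 0<y

  r₀ : ℚ
  r₀ = proj₁ p₀

  0<r₀ : 0ℚ ℚ.< r₀
  0<r₀ = proj₁ (proj₂ p₀)

  r₀≤1 : r₀ ℚ.≤ 1ℚ
  r₀≤1 = ℚₚ.<⇒≤ (y≤1 (proj₂ (proj₂ p₀)))

  r₀-Guaranteed : Guaranteed x y r₀
  r₀-Guaranteed = y-Guaranteed 0<x (proj₂ (proj₂ p₀))

  s : ℝ
  s = record
    -- The strict `q < r` leaves the cut without a greatest element; `r ≤ 1` keeps it proper and
    -- gives `s ≤ 1`.
    { cut       = λ q → ∃[ r ] q ℚ.< r × r ℚ.≤ 1ℚ × Guaranteed x y r
    ; inhabited = 0ℚ , r₀ , 0<r₀ , r₀≤1 , r₀-Guaranteed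
    ; proper    = 1ℚ , λ (r , 1<r , r≤1 , _) → ℚₚ.<-irrefl refl (ℚₚ.<-≤-trans 1<r r≤1)
    ; closed    = λ p<q (r , q<r , rest) → r , ℚₚ.<-trans p<q q<r , rest
    ; rounded   = λ (r , p<r , rest) →
                    let q , p<q , q<r = ℚₚ.<-dense p<r in q , p<q , r , q<r , rest
    }

  upper : IsUpperBound (Z x y) s
  upper z z∈Z@((_ , z≤1) , _) p∈z =
    -- The cut of `s` asks for a threshold strictly above `p`.
    let r , p<r , r∈z = rounded z p∈z
    in r , p<r , ℚₚ.<⇒≤ (z≤1 r∈z) , Z⇒Guaranteed {z = z} z∈Z r∈z

  least : ∀ u → IsUpperBound (Z x y) u → s ≤ u
  least u bound (r , q<r , r≤1 , guaranteed) with 0ℚ ℚₚ.<? r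
  ... | yes 0<r = bound (fromℚ r) (Guaranteed⇒Z 0<r r≤1 guaranteed) q<r
  -- Here `fromℚ r` is not positive, hence not in `Z x y`; but `q < r ≤ 0 < r₀`, so `fromℚ r₀`
  -- serves instead.
  ... | no  0≮r = bound (fromℚ r₀) (Guaranteed⇒Z 0<r₀ r₀≤1 r₀-Guaranteed)
                        (ℚₚ.<-trans (ℚₚ.<-≤-trans q<r (ℚₚ.≮⇒≥ 0≮r)) 0<r₀)

  s∈Z : s ∈ Z x y
  s∈Z = ((0ℚ , (r₀ , 0<r₀ , r₀≤1 , r₀-Guaranteed) , ℚₚ.<-irrefl refl) ,
         λ (r , q<r , r≤1 , _) → ℚₚ.<-≤-trans q<r r≤1) ,
        below-Guaranteed s λ (r , p<r , _ , guaranteed) → r , p<r , guaranteed
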